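{- Let $n\ge 7$ and let $G\in B^{++}_n$. (1) $\mathrm{irr}_t(G)\ge 2n-4$. Equality holds if and only if the degree sequence of $G$ is $(3,3,2,\ldots,2)$, i.e. two vertices of degree $3$ and $n-2$ vertices of degree $2$. (2) If the degree sequence of $G$ is not $(3,3,2,\ldots,2)$, then $\mathrm{irr}_t(G)\ge 4n-10$. Equality holds if and only if the degree sequence of $G$ is $(3,3,3,2,\ldots,2,1)$, i.e. three vertices of degree $3$, $n-4$ vertices of degree $2$ and one vertex of degree $1$.
   Context: A bicyclic graph is a simple connected graph whose number of edges equals its number of vertices plus one. For a graph $G=(V,E)$ and $w\in V$, $d_G(w)$ is the degree of $w$. The total irregularity is $\mathrm{irr}_t(G)=\frac12\sum_{x,y\in V}|d_G(x)-d_G(y)|$, where the sum runs over all ordered pairs of vertices. Degree sequences are listed in nonincreasing order. For $p,q\ge 3$ and $l\ge 1$, the $\infty$-graph $\infty(p,q,l)$ is obtained from two vertex-disjoint cycles $C_p$ and $C_q$ by joining a vertex of $C_p$ and a vertex of $C_q$ with a path having $l$ vertices (i.e. length $l-1$). $B^{++}_n$ denotes the set of bicyclic graphs on $n$ vertices obtained from some $\infty(p,q,l)$ with $l\ge 2$ by attaching trees. Equivalently, these are the bicyclic graphs on $n$ vertices whose two cycles are vertex-disjoint. -}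

module Defs where

open import Data.Fin using (Fin; zero; suc; toℕ; _<?_)
open import Data.List using (List; length; filter; map; allFin; cartesianProduct)
import Data.List.Sort as Sort
open import Data.Nat using (ℕ; suc; _+_; _∸_; _≤_; _≤?_; _≟_; _/_; ∣_-_∣; s≤s)
open import Data.Nat.ListAction using (sum)
open import Data.Nat.Properties using (≤-decTotalOrder; m+1+n≢m; 1+n≢n)
open import Data.Product using (Σ-syntax; _×_; _,_)
open import Data.Sum using (_⊎_; inj₁; inj₂; swap)
open import Function using (_⇔_; _↔_; Inverse)
open import Level using (0ℓ)
open import Relation.Binary using (Rel; Symmetric; Irreflexive; Decidable)
open import Relation.Binary.Construct.Closure.ReflexiveTransitive using (Star)
import Relation.Binary.Construct.Flip.EqAndOrd as Flip
open import Relation.Binary.PropositionalEquality using (_≡_; refl; sym)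
open import Relation.Nullary using (¬_)
open import Relation.Nullary.Decidable using (_×-dec_; _⊎-dec_)

record Graph (n : ℕ) : Set₁ where
  infix 4 _~_ _~?_
  field
    _~_      : Rel (Fin n) 0ℓ
    _~?_     : Decidable _~_
    ~-sym    : Symmetric _~_
    ~-irrefl : Irreflexive _≡_ _~_

module _ {n : ℕ} (G : Graph n) where
  open Graph G

  degree : Fin n → ℕ
  degree x = length (filter (x ~?_) (allFin n))

  numEdges : ℕ
  numEdges = length (filter (λ (x , y) → (x <? y) ×-dec (x ~? y))
                            (cartesianProduct (allFin n) (allFin n)))

  Connected : Set
  Connected = ∀ x y → Star _~_ x y

  IsTree : Set
  IsTree = Connected × suc numEdges ≡ n

  IsBicyclic : Set
  IsBicyclic = Connected × numEdges ≡ suc n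

  -- The sum over ordered pairs is even (it is symmetric and vanishes on the
  -- diagonal), so the division by 2 is exact.
  irrₜ : ℕ
  irrₜ = sum (map (λ (x , y) → ∣ degree x - degree y ∣)
                  (cartesianProduct (allFin n) (allFin n))) / 2

  -- Sorting by ≥ lists the degrees in nonincreasing order.
  degreeSequence : List ℕ
  degreeSequence = Sort.sort (Flip.decTotalOrder ≤-decTotalOrder)
                             (map degree (allFin n))

-- Edges of the path a, a+1, …, b and of the cycle a, a+1, …, b, a, each listed
-- in one orientation only.
PathEdge CycleEdge : ℕ → ℕ → Rel ℕ 0ℓ
PathEdge  a b i j = a ≤ i × j ≡ suc i × j ≤ b
CycleEdge a b i j = PathEdge a b i j ⊎ (i ≡ a × j ≡ b)

pathEdge? : ∀ a b → Decidable (PathEdge a b)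
pathEdge? a b i j = (a ≤? i) ×-dec ((j ≟ suc i) ×-dec (j ≤? b))

cycleEdge? : ∀ a b → Decidable (CycleEdge a b)
cycleEdge? a b i j = pathEdge? a b i j ⊎-dec ((i ≟ a) ×-dec (j ≟ b))

-- For p, q ≥ 3 and l ≥ 1, the graph ∞(p,q,l) has p + q + l - 2 vertices.  With
--   s = p - 1,  t = s + (l - 1),  e = t + (q - 1),
-- number them so that C_p is the cycle on 0, …, s, the joining path (with l
-- vertices, its ends included) runs from s to t, and C_q is the cycle on
-- t, …, e.
module _ (p q l : ℕ) where
  private
    s t e : ℕ
    s = p ∸ 1
    t = s + (l ∸ 1)
    e = t + (q ∸ 1)

  ∞-order : ℕ
  ∞-order = suc e

  ∞-Edge : Rel ℕ 0ℓ
  ∞-Edge i j = CycleEdge 0 s i j ⊎ PathEdge s t i j ⊎ CycleEdge t e i j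

  ∞-edge? : Decidable ∞-Edge
  ∞-edge? i j = cycleEdge? 0 s i j ⊎-dec (pathEdge? s t i j ⊎-dec cycleEdge? t e i j)

private
  pathEdge-irrefl : ∀ {a b i} → ¬ PathEdge a b i i
  pathEdge-irrefl (_ , i≡1+i , _) = 1+n≢n (sym i≡1+i)

  ∞-edge-irrefl : ∀ p q l → 3 ≤ p → 3 ≤ q → ∀ {i} → ¬ ∞-Edge p q l i i
  ∞-edge-irrefl _ _ _ _ _ (inj₁ (inj₁ r)) = pathEdge-irrefl r
  ∞-edge-irrefl _ _ _ (s≤s (s≤s _)) _ (inj₁ (inj₂ (refl , ())))
  ∞-edge-irrefl _ _ _ _ _ (inj₂ (inj₁ r)) = pathEdge-irrefl r
  ∞-edge-irrefl _ _ _ _ _ (inj₂ (inj₂ (inj₁ r))) = pathEdge-irrefl r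
  ∞-edge-irrefl _ _ _ _ (s≤s (s≤s _)) (inj₂ (inj₂ (inj₂ (refl , r)))) = m+1+n≢m _ (sym r)

∞-graph : ∀ p q l → 3 ≤ p → 3 ≤ q → Graph (∞-order p q l)
∞-graph p q l 3≤p 3≤q = record
  { _~_      = λ x y → ∞-Edge p q l (toℕ x) (toℕ y) ⊎ ∞-Edge p q l (toℕ y) (toℕ x)
  ; _~?_     = λ x y → ∞-edge? p q l (toℕ x) (toℕ y) ⊎-dec ∞-edge? p q l (toℕ y) (toℕ x)
  ; ~-sym    = swap
  ; ~-irrefl = λ { refl (inj₁ r) → ∞-edge-irrefl p q l 3≤p 3≤q r
                 ; refl (inj₂ r) → ∞-edge-irrefl p q l 3≤p 3≤q r }
  }

-- The graph obtained from H by identifying each vertex a with the vertex zero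
-- (the root) of a tree T a.  A tree with one vertex attaches nothing.
module _ {m : ℕ} (H : Graph m) (k : Fin m → ℕ) (T : ∀ a → Graph (suc (k a))) where

  GluedVertex : Set
  GluedVertex = Σ[ a ∈ Fin m ] Fin (suc (k a))

  data GluedEdge : Rel GluedVertex 0ℓ where
    base : ∀ {a b} → Graph._~_ H a b → GluedEdge (a , zero) (b , zero)
    tree : ∀ {a i j} → Graph._~_ (T a) i j → GluedEdge (a , i) (a , j)

record ObtainedByAttachingTrees {m n : ℕ} (H : Graph m) (G : Graph n) : Set₁ where
  field
    k      : Fin m → ℕ
    T      : ∀ a → Graph (suc (k a))
    isTree : ∀ a → IsTree (T a)
    iso    : Fin n ↔ GluedVertex H k T
    iso-~  : ∀ x y → Graph._~_ G x y ⇔ GluedEdge H k T (Inverse.to iso x) (Inverse.to iso y)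

record B⁺⁺ {n : ℕ} (G : Graph n) : Set₁ where
  field
    bicyclic : IsBicyclic G
    p q l    : ℕ
    3≤p      : 3 ≤ p
    3≤q      : 3 ≤ q
    2≤l      : 2 ≤ l
    attached : ObtainedByAttachingTrees (∞-graph p q l 3≤p 3≤q) G

{-# OPTIONS --safe #-}
-- Let A be the number of leaves, B the number of vertices of degree at least 3,
-- and E the sum of d ∸ 2 over all degrees d.  From
--   ∣x - y∣ = ∣x ⊓ 2 - y ⊓ 2∣ + ∣(x ∸ 2) - (y ∸ 2)∣
-- one gets irrₜ ≥ A (n - A) + E (n - B), with equality when all degrees are at
-- most 3.  The handshake lemma gives E = A + 2, and B ≥ 2 because the two
-- vertices where the joining path meets the cycles have degree at least 3.
-- Without leaves this forces the degrees 3, 3, 2, …, 2; with a leaf the bound is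
-- at least 4 n - 10, and equal to it only if A = 1 and B = 3.
module Submission where

open import Defs
open import Data.Empty using (⊥-elim)
open import Data.Fin using (Fin; zero; suc; toℕ; fromℕ<; _<?_)
open import Data.Fin.Properties using (toℕ-fromℕ<) renaming (<-cmp to <-cmpᶠ; <-asym to <-asymᶠ)
open import Data.List using (List; _∷_; []; _++_; replicate; map; length; filter; allFin; cartesianProduct)
open import Data.List.Membership.Propositional using (_∈_)
open import Data.List.Membership.Propositional.Properties using (∈-∃++; ∈-filter⁺; ∈-allFin)
open import Data.List.Properties using (map-++; map-∘; map-cong; map-cong-local; length-map; length-tabulate; map-id; ++-identityʳ)
open import Data.List.Relation.Binary.Permutation.Propositional using (_↭_; ↭-sym)
open import Data.List.Relation.Binary.Permutation.Propositional.Properties using (map⁺; shift; ↭-length; ∈-resp-↭; All-resp-↭)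
open import Data.List.Relation.Unary.All as All using (All; []; _∷_)
import Data.List.Relation.Unary.All.Properties as All
open import Data.List.Relation.Unary.AllPairs using (AllPairs; []; _∷_)
open import Data.List.Relation.Unary.Any using (here; there)
open import Data.List.Relation.Unary.Linked.Properties using (Linked⇒AllPairs)
open import Data.List.Relation.Unary.Unique.Propositional using (Unique)
import Data.List.Sort as Sort
open import Data.Nat using (ℕ; zero; suc; _+_; _*_; _∸_; _≤_; _<_; _≥_; _≤?_; _≟_; _/_; ∣_-_∣; z≤n; s≤s)
open import Data.Nat.DivMod using (/-monoˡ-≤; m*n/n≡m)
open import Data.Nat.ListAction using (sum)
open import Data.Nat.ListAction.Properties using (sum-++; sum-↭)
open import Data.Nat.Properties hiding (_<?_)
open import Data.Nat.Tactic.RingSolver using (solve-∀)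
open import Data.Product using (_×_; _,_; proj₁; proj₂)
open import Data.Sum using (_⊎_; inj₁; inj₂; [_,_]′)
open import Function using (_⇔_; _∘_; Equivalence; Inverse; mk⇔)
open import Relation.Binary using (tri<; tri≈; tri>)
open import Relation.Binary.Construct.Closure.ReflexiveTransitive using (ε; _◅_)
import Relation.Binary.Construct.Flip.EqAndOrd as Flip
open import Relation.Binary.PropositionalEquality
open import Relation.Nullary using (¬_; Dec; yes; no)
open import Relation.Nullary.Decidable using (_×-dec_)
open import Relation.Unary using (Decidable)

-- Finite sums over lists.

private variable
  X Y : Set

∑ : (X → ℕ) → List X → ℕ
∑ f xs = sum (map f xs)

⟦_⟧ : {P : Set} → Dec P → ℕ
⟦ yes _ ⟧ = 1
⟦ no _ ⟧  = 0

interchange : ∀ a b c d → (a + b) + (c + d) ≡ (a + c) + (b + d)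
interchange = solve-∀

∑-cong : {f g : X → ℕ} → (∀ x → f x ≡ g x) → ∀ xs → ∑ f xs ≡ ∑ g xs
∑-cong eq xs = cong sum (map-cong eq xs)

∑-mono-≤ : {f g : X → ℕ} → (∀ x → f x ≤ g x) → ∀ xs → ∑ f xs ≤ ∑ g xs
∑-mono-≤ le []       = z≤n
∑-mono-≤ le (x ∷ xs) = +-mono-≤ (le x) (∑-mono-≤ le xs)

-- A strict inequality at one entry could not be made up for at the others. Applied to `big` and
-- `excess`, this limits the degrees to at most 3.
∑-squeeze : {f g : X → ℕ} → (∀ x → f x ≤ g x) → ∀ xs → ∑ f xs ≡ ∑ g xs →
            All (λ x → f x ≡ g x) xs
∑-squeeze le []       eq = []
∑-squeeze {f = f} {g} le (x ∷ xs) eq = fx≡gx ∷ ∑-squeeze le xs rest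
  where
  fx≡gx : f x ≡ g x
  fx≡gx = ≤-antisym (le x) (+-cancelʳ-≤ (∑ f xs) (g x) (f x)
    (≤-trans (+-monoʳ-≤ (g x) (∑-mono-≤ le xs)) (≤-reflexive (sym eq))))
  rest : ∑ f xs ≡ ∑ g xs
  rest = +-cancelˡ-≡ (g x) _ _ (trans (cong (_+ ∑ f xs) (sym fx≡gx)) eq)

∑-+ : (f g : X → ℕ) → ∀ xs → ∑ (λ x → f x + g x) xs ≡ ∑ f xs + ∑ g xs
∑-+ f g []       = refl
∑-+ f g (x ∷ xs) = trans (cong (f x + g x +_) (∑-+ f g xs))
                         (interchange (f x) (g x) (∑ f xs) (∑ g xs))

∑-*ˡ : ∀ c (f : X → ℕ) xs → ∑ (λ x → c * f x) xs ≡ c * ∑ f xs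
∑-*ˡ c f []       = sym (*-zeroʳ c)
∑-*ˡ c f (x ∷ xs) = trans (cong (c * f x +_) (∑-*ˡ c f xs)) (sym (*-distribˡ-+ c (f x) _))

∑-*ʳ : ∀ (f : X → ℕ) c xs → ∑ (λ x → f x * c) xs ≡ ∑ f xs * c
∑-*ʳ f c xs = trans (∑-cong (λ x → *-comm (f x) c) xs)
                    (trans (∑-*ˡ c f xs) (*-comm c _))

∑-const : ∀ c (xs : List X) → ∑ (λ _ → c) xs ≡ length xs * c
∑-const c []       = refl
∑-const c (x ∷ xs) = cong (c +_) (∑-const c xs)

∑-zero : {f : X → ℕ} → ∀ {xs} → All (λ x → f x ≡ 0) xs → ∑ f xs ≡ 0
∑-zero []         = refl
∑-zero (fx≡0 ∷ p) = cong₂ _+_ fx≡0 (∑-zero p)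

∑-swap : (h : X → Y → ℕ) → ∀ xs ys →
         ∑ (λ x → ∑ (h x) ys) xs ≡ ∑ (λ y → ∑ (λ x → h x y) xs) ys
∑-swap h []       ys = sym (trans (∑-const 0 ys) (*-zeroʳ (length ys)))
∑-swap h (x ∷ xs) ys = trans (cong (∑ (h x) ys +_) (∑-swap h xs ys))
                             (sym (∑-+ (h x) (λ y → ∑ (λ x′ → h x′ y) xs) ys))

∑-cartesianProduct : (h : X × Y → ℕ) → ∀ xs ys →
  ∑ h (cartesianProduct xs ys) ≡ ∑ (λ x → ∑ (λ y → h (x , y)) ys) xs
∑-cartesianProduct h []       ys = refl
∑-cartesianProduct h (x ∷ xs) ys = begin
  sum (map h (map (x ,_) ys ++ cartesianProduct xs ys))
    ≡⟨ cong sum (map-++ h (map (x ,_) ys) _) ⟩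
  sum (map h (map (x ,_) ys) ++ map h (cartesianProduct xs ys))
    ≡⟨ sum-++ (map h (map (x ,_) ys)) _ ⟩
  sum (map h (map (x ,_) ys)) + ∑ h (cartesianProduct xs ys)
    ≡⟨ cong₂ _+_ (cong sum (sym (map-∘ ys))) (∑-cartesianProduct h xs ys) ⟩
  ∑ (λ y → h (x , y)) ys + ∑ (λ x → ∑ (λ y → h (x , y)) ys) xs ∎
  where open ≡-Reasoning

-- Counting by indicators and by duplicate-free lists.

length-filter≡∑ : {P : X → Set} (P? : Decidable P) → ∀ xs →
                  length (filter P? xs) ≡ ∑ (λ x → ⟦ P? x ⟧) xs
length-filter≡∑ P? []       = refl
length-filter≡∑ P? (x ∷ xs) with P? x
... | yes _ = cong suc (length-filter≡∑ P? xs)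
... | no  _ = length-filter≡∑ P? xs

-- Pigeonhole by induction on `xs`: the head is cut out of `ys`, and the other entries survive the
-- cut because they differ from it.
Unique⇒length≤ : {xs ys : List X} → Unique xs → All (_∈ ys) xs → length xs ≤ length ys
Unique⇒length≤ []           []          = z≤n
Unique⇒length≤ {xs = x ∷ xs} (x∉xs ∷ u) (x∈ys ∷ xs⊆ys) with as , bs , refl ← ∈-∃++ x∈ys =
  ≤-trans (s≤s (Unique⇒length≤ u (All.zipWith (λ (x≢z , z∈ys) → drop x≢z z∈ys) (x∉xs , xs⊆ys))))
          (≤-reflexive (sym (↭-length (shift x as bs))))
  where
  drop : ∀ {z} → x ≢ z → z ∈ as ++ x ∷ bs → z ∈ as ++ bs
  drop x≢z z∈ys with ∈-resp-↭ (shift x as bs) z∈ys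
  ... | here z≡x = ⊥-elim (x≢z (sym z≡x))
  ... | there p  = p

-- For the handshake lemma, where an adjacency has exactly one of two orientations.
⟦⟧-⊎ : {P Q R : Set} (P? : Dec P) (Q? : Dec Q) (R? : Dec R) →
       (P → Q ⊎ R) → (Q → P) → (R → P) → (Q → ¬ R) → ⟦ P? ⟧ ≡ ⟦ Q? ⟧ + ⟦ R? ⟧
⟦⟧-⊎ (yes p) (yes q) (yes r) f g h d = ⊥-elim (d q r)
⟦⟧-⊎ (yes p) (yes q) (no ¬r) f g h d = refl
⟦⟧-⊎ (yes p) (no ¬q) (yes r) f g h d = refl
⟦⟧-⊎ (yes p) (no ¬q) (no ¬r) f g h d = ⊥-elim ([ ¬q , ¬r ]′ (f p))
⟦⟧-⊎ (no ¬p) (yes q) R?      f g h d = ⊥-elim (¬p (g q))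
⟦⟧-⊎ (no ¬p) (no ¬q) (yes r) f g h d = ⊥-elim (¬p (h r))
⟦⟧-⊎ (no ¬p) (no ¬q) (no ¬r) f g h d = refl

-- Degree classes and a pointwise lower bound for the distance of two degrees.

-- `leaf` also accepts 0, so that the classes partition all natural numbers; positivity of the
-- degrees excludes that value where it would matter.
leaf nonleaf small big mid excess : ℕ → ℕ
leaf d    = ⟦ d ≤? 1 ⟧
nonleaf d = ⟦ 2 ≤? d ⟧
mid d     = ⟦ d ≟ 2 ⟧
small d   = ⟦ d ≤? 2 ⟧
big d     = ⟦ 3 ≤? d ⟧
excess d  = d ∸ 2

leaf+nonleaf : ∀ d → leaf d + nonleaf d ≡ 1
leaf+nonleaf 0             = refl
leaf+nonleaf 1             = refl
leaf+nonleaf (suc (suc d)) = refl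

small+big : ∀ d → small d + big d ≡ 1
small+big 0                   = refl
small+big 1                   = refl
small+big 2                   = refl
small+big (suc (suc (suc d))) = refl

leaf+mid+big : ∀ d → leaf d + mid d + big d ≡ 1
leaf+mid+big 0                   = refl
leaf+mid+big 1                   = refl
leaf+mid+big 2                   = refl
leaf+mid+big (suc (suc (suc d))) = refl

big≤excess : ∀ d → big d ≤ excess d
big≤excess 0                   = z≤n
big≤excess 1                   = z≤n
big≤excess 2                   = z≤n
big≤excess (suc (suc (suc d))) = s≤s z≤n

big≡excess⇒≤3 : ∀ {d} → big d ≡ excess d → d ≤ 3
big≡excess⇒≤3 {0} _ = z≤n
big≡excess⇒≤3 {1} _ = s≤s z≤n
big≡excess⇒≤3 {2} _ = s≤s (s≤s z≤n)
big≡excess⇒≤3 {3} _ = ≤-refl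
big≡excess⇒≤3 {suc (suc (suc (suc d)))} ()

-- A leaf is the only positive degree at which truncation changes d - 2, and there the error is 1.
-- Summed over all degrees this yields E = A + 2.
d+leaf≡2+excess : ∀ {d} → 1 ≤ d → d + leaf d ≡ 2 + excess d
d+leaf≡2+excess {1}           _ = refl
d+leaf≡2+excess {suc (suc d)} _ = cong (2 +_) (+-identityʳ d)

-- For positive degrees the first bracket is the distance of x ⊓ 2 and y ⊓ 2. The second is the
-- distance of x ∸ 2 and y ∸ 2, except that it is 0 when both degrees exceed 2. Sums of products are
-- used so that the double sum factorises.
gap : ℕ → ℕ → ℕ
gap x y = (leaf x * nonleaf y + nonleaf x * leaf y) + (excess x * small y + small x * excess y)

gap≤∣-∣ : ∀ x y → gap x y ≤ ∣ x - y ∣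
gap≤∣-∣ 0 0 = z≤n
gap≤∣-∣ 0 1 = z≤n
gap≤∣-∣ 0 2 = s≤s z≤n
gap≤∣-∣ 0 (suc (suc (suc y))) rewrite +-identityʳ y = n≤1+n _
gap≤∣-∣ 1 0 = z≤n
gap≤∣-∣ 1 1 = z≤n
gap≤∣-∣ 1 2 = ≤-refl
gap≤∣-∣ 1 (suc (suc (suc y))) rewrite +-identityʳ y = ≤-refl
gap≤∣-∣ 2 0 = s≤s z≤n
gap≤∣-∣ 2 1 = ≤-refl
gap≤∣-∣ 2 2 = z≤n
gap≤∣-∣ 2 (suc (suc (suc y))) rewrite +-identityʳ y = ≤-refl
gap≤∣-∣ (suc (suc (suc x))) 0 rewrite *-identityʳ x | +-identityʳ x = n≤1+n _
gap≤∣-∣ (suc (suc (suc x))) 1 rewrite *-identityʳ x | +-identityʳ x = ≤-refl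
gap≤∣-∣ (suc (suc (suc x))) 2 rewrite *-identityʳ x | +-identityʳ x = ≤-refl
gap≤∣-∣ (suc (suc (suc x))) (suc (suc (suc y))) rewrite *-zeroʳ x = z≤n

-- The pairs of degrees above 2, which `gap` drops, reduce to (3, 3), whose distance is 0.
gap≡∣-∣ : ∀ {x y} → 1 ≤ x × x ≤ 3 → 1 ≤ y × y ≤ 3 → gap x y ≡ ∣ x - y ∣
gap≡∣-∣ {1} {1} _ _ = refl
gap≡∣-∣ {1} {2} _ _ = refl
gap≡∣-∣ {1} {3} _ _ = refl
gap≡∣-∣ {2} {1} _ _ = refl
gap≡∣-∣ {2} {2} _ _ = refl
gap≡∣-∣ {2} {3} _ _ = refl
gap≡∣-∣ {3} {1} _ _ = refl
gap≡∣-∣ {3} {2} _ _ = refl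
gap≡∣-∣ {3} {3} _ _ = refl
gap≡∣-∣ {suc (suc (suc (suc _)))} (_ , s≤s (s≤s (s≤s ()))) _
gap≡∣-∣ {_} {suc (suc (suc (suc _)))} _ (_ , s≤s (s≤s (s≤s ())))

-- Double sums and the lower bound for the irregularity of a degree list.

∑∑ : (ℕ → ℕ → ℕ) → List ℕ → ℕ
∑∑ h ds = ∑ (λ x → ∑ (h x) ds) ds

∑∑-+ : ∀ h k ds → ∑∑ (λ x y → h x y + k x y) ds ≡ ∑∑ h ds + ∑∑ k ds
∑∑-+ h k ds = trans (∑-cong (λ x → ∑-+ (h x) (k x) ds) ds) (∑-+ _ _ ds)

∑∑-* : ∀ f g ds → ∑∑ (λ x y → f x * g y) ds ≡ ∑ f ds * ∑ g ds
∑∑-* f g ds = trans (∑-cong (λ x → ∑-*ˡ (f x) g ds) ds) (∑-*ʳ f _ ds)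

-- This is A (n - A) + E (n - B): `nonleaf` counts n - A degrees and `small` counts n - B.
irrBound : List ℕ → ℕ
irrBound ds = ∑ leaf ds * ∑ nonleaf ds + ∑ excess ds * ∑ small ds

-- Each product in `gap` separates x from y, so its double sum is a product of two single sums. Each
-- product occurs in both orders, whence the factor 2.
∑∑-gap : ∀ ds → ∑∑ gap ds ≡ 2 * irrBound ds
∑∑-gap ds = begin
  ∑∑ gap ds
    ≡⟨ ∑∑-+ (λ x y → leaf x * nonleaf y + nonleaf x * leaf y)
            (λ x y → excess x * small y + small x * excess y) ds ⟩
  ∑∑ (λ x y → leaf x * nonleaf y + nonleaf x * leaf y) ds
    + ∑∑ (λ x y → excess x * small y + small x * excess y) ds
    ≡⟨ cong₂ _+_ (sym-pair leaf nonleaf) (sym-pair excess small) ⟩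
  2 * (∑ leaf ds * ∑ nonleaf ds) + 2 * (∑ excess ds * ∑ small ds)
    ≡⟨ *-distribˡ-+ 2 (∑ leaf ds * ∑ nonleaf ds) _ ⟨
  2 * irrBound ds ∎
  where
  open ≡-Reasoning
  double : ∀ a b → a * b + b * a ≡ 2 * (a * b)
  double = solve-∀
  sym-pair : ∀ f g → ∑∑ (λ x y → f x * g y + g x * f y) ds ≡ 2 * (∑ f ds * ∑ g ds)
  sym-pair f g = trans (∑∑-+ (λ x y → f x * g y) (λ x y → g x * f y) ds)
    (trans (cong₂ _+_ (∑∑-* f g ds) (∑∑-* g f ds)) (double (∑ f ds) (∑ g ds)))

-- The total irregularity as a function of the degree list alone, so that the extremal argument is
-- pure arithmetic.
irrOf : List ℕ → ℕ
irrOf ds = ∑∑ ∣_-_∣ ds / 2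

half : ∀ m → 2 * m / 2 ≡ m
half m = trans (cong (_/ 2) (*-comm 2 m)) (m*n/n≡m m 2)

irrBound≤irr : ∀ ds → irrBound ds ≤ irrOf ds
irrBound≤irr ds = ≤-trans (≤-reflexive (sym (half (irrBound ds)))) (/-monoˡ-≤ 2
  (≤-trans (≤-reflexive (sym (∑∑-gap ds)))
           (∑-mono-≤ (λ x → ∑-mono-≤ (gap≤∣-∣ x) ds) ds)))

irrBound≡irr : ∀ {ds} → All (λ d → 1 ≤ d × d ≤ 3) ds → irrBound ds ≡ irrOf ds
irrBound≡irr {ds} p = trans (sym (half (irrBound ds))) (cong (_/ 2) (trans (sym (∑∑-gap ds))
  (cong sum (map-cong-local (All.map (λ px → cong sum (map-cong-local (All.map (gap≡∣-∣ px) p))) p)))))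

-- Class counts and the shape of a sorted degree list.

∑-partition : ∀ (f g : X → ℕ) → (∀ d → f d + g d ≡ 1) → ∀ ds → ∑ f ds + ∑ g ds ≡ length ds
∑-partition f g eq ds = begin
  ∑ f ds + ∑ g ds          ≡⟨ ∑-+ f g ds ⟨
  ∑ (λ d → f d + g d) ds   ≡⟨ ∑-cong eq ds ⟩
  ∑ (λ _ → 1) ds           ≡⟨ ∑-const 1 ds ⟩
  length ds * 1            ≡⟨ *-identityʳ _ ⟩
  length ds ∎
  where open ≡-Reasoning

-- Induction on the list: after a head 2 no entry is `big`, and after a head 1 none is `big` or
-- `mid`. The earlier blocks are then empty and the head opens its own block.
sorted-profile : ∀ {ds} → AllPairs _≥_ ds → All (λ d → 1 ≤ d × d ≤ 3) ds →
  ds ≡ replicate (∑ big ds) 3 ++ replicate (∑ mid ds) 2 ++ replicate (∑ leaf ds) 1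
sorted-profile [] [] = refl
sorted-profile {3 ∷ ds} (_ ∷ s) (_ ∷ p) = cong (3 ∷_) (sorted-profile s p)
sorted-profile {2 ∷ ds} (ds≤2 ∷ s) (_ ∷ p)
  with ∑ big ds | ∑-zero {f = big} (All.map (λ { {0} _ → refl ; {1} _ → refl ; {2} _ → refl
                                     ; {suc (suc (suc _))} (s≤s (s≤s ())) }) ds≤2)
     | sorted-profile s p
... | _ | refl | eq = cong (2 ∷_) eq
sorted-profile {1 ∷ ds} (ds≤1 ∷ s) (_ ∷ p)
  with ∑ big ds | ∑-zero {f = big} (All.map (λ { {0} _ → refl ; {1} _ → refl
                                     ; {suc (suc _)} (s≤s ()) }) ds≤1)
     | ∑ mid ds | ∑-zero {f = mid} (All.map (λ { {0} _ → refl ; {1} _ → refl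
                                     ; {suc (suc _)} (s≤s ()) }) ds≤1)
     | sorted-profile s p
... | _ | refl | _ | refl | eq = cong (1 ∷_) eq
sorted-profile {suc (suc (suc (suc _))) ∷ _} _ ((_ , s≤s (s≤s (s≤s ()))) ∷ _)

∑-replicate : ∀ (f : ℕ → ℕ) k d → ∑ f (replicate k d) ≡ k * f d
∑-replicate f zero    d = refl
∑-replicate f (suc k) d = cong (f d +_) (∑-replicate f k d)

-- The arithmetic inequality for degree lists with a leaf.

-- Here n′ = n - A and Z = n - B, so that no subtraction occurs.
leaf-bound : ∀ A n′ B Z → 1 ≤ A → 2 ≤ B → B ≤ A + 2 → B + Z ≡ A + n′ → 7 ≤ A + n′ → B ≤ n′ →
  let M = A * n′ + (A + 2) * Z in
  4 * (A + n′) ≤ M + 10 × (M + 10 ≡ 4 * (A + n′) → A ≡ 1 × B ≡ 3)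
leaf-bound (suc a) n′ B Z _ 2≤B B≤A+2 B+Z≡n 7≤n B≤n′ with suc a + 2 ≤? n′
-- With A = 1 + a, n′ = A + 2 + r and A + 2 = B + j, both sides become polynomials in a, r and j.
... | yes A+2≤n′ with r , refl ← m≤n⇒∃[o]m+o≡n A+2≤n′ | j , B+j≡ ← m≤n⇒∃[o]m+o≡n B≤A+2 =
      ≤-trans (m≤m+n _ _) (≤-reflexive (sym identity)) , λ eq → tight (slack≡0 eq)
  where
  -- The exact difference M + 10 - 4 n. Its first term vanishes only for a = 0 and its second only
  -- for j = 0, that is, for A = 1 and B = A + 2.
  slack : ℕ
  slack = 2 * (a * (a + r)) + (a + 3) * j
  Z≡ : Z ≡ suc a + r + j
  Z≡ = +-cancelˡ-≡ B _ _ (trans B+Z≡n (trans (cong (suc a +_) (cong (_+ r) (sym B+j≡))) (rearrange a B j r)))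
    where
    rearrange : ∀ a B j r → suc a + (B + j + r) ≡ B + (suc a + r + j)
    rearrange = solve-∀
  polynomial : ∀ a r j →
    (1 + a) * (1 + a + 2 + r) + (1 + a + 2) * (1 + a + r + j) + 10
    ≡ 4 * (1 + a + (1 + a + 2 + r)) + (2 * (a * (a + r)) + (a + 3) * j)
  polynomial = solve-∀
  identity : suc a * (suc a + 2 + r) + (suc a + 2) * Z + 10
           ≡ 4 * (suc a + (suc a + 2 + r)) + slack
  identity rewrite Z≡ = polynomial a r j
  slack≡0 : _ → slack ≡ 0
  slack≡0 eq = +-cancelˡ-≡ (4 * (suc a + (suc a + 2 + r))) _ _
    (trans (sym identity) (trans eq (sym (+-identityʳ _))))
  tight : slack ≡ 0 → suc a ≡ 1 × B ≡ 3
  tight s≡0 = cong suc a≡0 , B≡3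
    where
    a≡0 : a ≡ 0
    a≡0 with m*n≡0⇒m≡0∨n≡0 a (m+n≡0⇒m≡0 (a * (a + r)) (m+n≡0⇒m≡0 (2 * (a * (a + r))) s≡0))
    ... | inj₁ e = e
    ... | inj₂ e = m+n≡0⇒m≡0 a e
    j≡0 : j ≡ 0
    j≡0 with m*n≡0⇒m≡0∨n≡0 (a + 3) (m+n≡0⇒n≡0 (2 * (a * (a + r))) s≡0)
    ... | inj₁ e with () ← m+n≡0⇒n≡0 a e
    ... | inj₂ e = e
    B≡3 : B ≡ 3
    B≡3 = trans (sym (+-identityʳ B)) (trans (cong (B +_) (sym j≡0)) (trans B+j≡ (cong (λ a → suc a + 2) a≡0)))
-- Here n′ ≤ A + 1 and the inequality is strict, so the equality case is vacuous.
... | no A+2≰n′ = <⇒≤ 4n<M+10 , λ eq → ⊥-elim (<-irrefl (sym eq) 4n<M+10)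
  where
  open ≤-Reasoning
  n′≤1+A : n′ ≤ suc a + 1
  n′≤1+A = ≤-pred (≤-trans (≰⇒> A+2≰n′) (≤-reflexive (+-suc (suc a) 1)))
  A≤Z : suc a ≤ Z
  A≤Z = +-cancelˡ-≤ B _ _ (begin
    B + suc a  ≤⟨ +-monoˡ-≤ (suc a) B≤n′ ⟩
    n′ + suc a ≡⟨ +-comm n′ (suc a) ⟩
    suc a + n′ ≡⟨ B+Z≡n ⟨
    B + Z ∎)
  7≤3+2a : 7 ≤ suc a + (suc a + 1)
  7≤3+2a = ≤-trans 7≤n (+-monoʳ-≤ (suc a) n′≤1+A)
  -- For A = 3 + c, with Z replaced by A, the difference contains (c - 1) m, where m = n′. As c - 1
  -- may be negative, m is added to both sides and bounded by 4 + c on the smaller one.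
  polynomial : ∀ c m → 1 + (4 * (3 + c + m)) + (8 + c * 3 + c * c + c * m + (4 + c))
                     ≡ (3 + c) * m + (3 + c + 2) * (3 + c) + 10 + m
  polynomial = solve-∀
  -- In this case 7 ≤ n ≤ 2 A + 1, which leaves only A ≥ 3.
  bound : ∀ a → 7 ≤ suc a + (suc a + 1) → n′ ≤ suc a + 1 →
          4 * (suc a + n′) < suc a * n′ + (suc a + 2) * suc a + 10
  bound 0 (s≤s (s≤s (s≤s ()))) _
  bound 1 (s≤s (s≤s (s≤s (s≤s (s≤s ()))))) _
  bound (suc (suc c)) _ n′≤ = +-cancelʳ-≤ n′ _ _ (begin
    suc (4 * (3 + c + n′)) + n′
      ≤⟨ +-monoʳ-≤ (suc (4 * (3 + c + n′))) (≤-trans n′≤ (≤-reflexive (+-comm (3 + c) 1))) ⟩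
    suc (4 * (3 + c + n′)) + (4 + c)
      ≤⟨ +-monoʳ-≤ (suc (4 * (3 + c + n′))) (m≤n+m (4 + c) (8 + c * 3 + c * c + c * n′)) ⟩
    suc (4 * (3 + c + n′)) + (8 + c * 3 + c * c + c * n′ + (4 + c))
      ≡⟨ polynomial c n′ ⟩
    (3 + c) * n′ + (3 + c + 2) * (3 + c) + 10 + n′ ∎)
  4n<M+10 : 4 * (suc a + n′) < suc a * n′ + (suc a + 2) * Z + 10
  4n<M+10 = ≤-trans (bound a 7≤3+2a n′≤1+A)
    (+-monoˡ-≤ 10 (+-monoʳ-≤ (suc a * n′) (*-monoʳ-≤ (suc a + 2) A≤Z)))

-- The two bounds and their equality cases for degree lists.

-- The graph enters through positive degrees, a degree sum of twice the n + 1 edges, and two degrees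
-- of at least 3. `σ` is the sorted list; being a permutation of `ds`, it has the same class counts.
irrOf-bounds : ∀ {n ds σ} → 7 ≤ n → length ds ≡ n → All (1 ≤_) ds → sum ds ≡ 2 * suc n →
  2 ≤ ∑ big ds → σ ↭ ds → AllPairs _≥_ σ →
    (2 * n ∸ 4 ≤ irrOf ds
    × (irrOf ds ≡ 2 * n ∸ 4 ⇔ σ ≡ 3 ∷ 3 ∷ replicate (n ∸ 2) 2))
    × (¬ (σ ≡ 3 ∷ 3 ∷ replicate (n ∸ 2) 2) →
    4 * n ∸ 10 ≤ irrOf ds
    × (irrOf ds ≡ 4 * n ∸ 10 ⇔ σ ≡ 3 ∷ 3 ∷ 3 ∷ replicate (n ∸ 4) 2 ++ 1 ∷ []))
irrOf-bounds {n} {ds} {σ} 7≤n len 1≤ds degree-sum 2≤B σ↭ds σ↘ = by-leaves (A ≟ 0)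
  where
  A B E M N′ Z : ℕ
  A  = ∑ leaf ds
  B  = ∑ big ds
  E  = ∑ excess ds
  N′ = ∑ nonleaf ds
  Z  = ∑ small ds
  M  = irrBound ds

  ∑σ : ∀ f → ∑ f σ ≡ ∑ f ds
  ∑σ f = sum-↭ (map⁺ f σ↭ds)

  A+N′≡n : A + N′ ≡ n
  A+N′≡n = trans (∑-partition leaf nonleaf leaf+nonleaf ds) len

  Z+B≡n : Z + B ≡ n
  Z+B≡n = trans (∑-partition small big small+big ds) len

  A+mid+B≡n : A + ∑ mid ds + B ≡ n
  A+mid+B≡n = trans (cong (_+ B) (sym (∑-+ leaf mid ds)))
    (trans (∑-partition (λ d → leaf d + mid d) big leaf+mid+big ds) len)

  B≤N′ : B ≤ N′
  B≤N′ = ∑-mono-≤ (λ { 0 → z≤n ; 1 → z≤n ; 2 → z≤n ; (suc (suc (suc _))) → ≤-refl }) ds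

  -- Evaluating the sum of d + `leaf` d = 2 + `excess` d in two ways gives 2 (n + 1) + A = 2 n + E.
  E≡A+2 : E ≡ A + 2
  E≡A+2 = +-cancelˡ-≡ (n * 2) _ _ (begin
    n * 2 + E                        ≡⟨ cong (λ m → m * 2 + E) len ⟨
    length ds * 2 + E                ≡⟨ cong (_+ E) (∑-const 2 ds) ⟨
    ∑ (λ _ → 2) ds + E               ≡⟨ ∑-+ (λ _ → 2) excess ds ⟨
    ∑ (λ d → 2 + excess d) ds        ≡⟨ cong sum (map-cong-local (All.map d+leaf≡2+excess 1≤ds)) ⟨
    ∑ (λ d → d + leaf d) ds          ≡⟨ ∑-+ (λ d → d) leaf ds ⟩
    ∑ (λ d → d) ds + A               ≡⟨ cong (λ ms → sum ms + A) (map-id ds) ⟩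
    sum ds + A                       ≡⟨ cong (_+ A) degree-sum ⟩
    2 * suc n + A                    ≡⟨ rearrange n A ⟩
    n * 2 + (A + 2) ∎)
    where
    open ≡-Reasoning
    rearrange : ∀ n A → 2 * suc n + A ≡ n * 2 + (A + 2)
    rearrange = solve-∀

  B≤A+2 : B ≤ A + 2
  B≤A+2 = ≤-trans (∑-mono-≤ big≤excess ds) (≤-reflexive E≡A+2)

  -- `big` is pointwise at most `excess`, so equal sums exclude degrees above 3. On the remaining
  -- degrees `irrBound` is exact.
  1≤ds≤3 : B ≡ E → All (λ d → 1 ≤ d × d ≤ 3) ds
  1≤ds≤3 B≡E = All.zip (1≤ds , All.map big≡excess⇒≤3 (∑-squeeze big≤excess ds B≡E))

  profile : B ≡ E → σ ≡ replicate B 3 ++ replicate (∑ mid ds) 2 ++ replicate A 1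
  profile B≡E = trans (sorted-profile σ↘ (All-resp-↭ (↭-sym σ↭ds) (1≤ds≤3 B≡E)))
    (cong₂ _++_ (cong (λ k → replicate k 3) (∑σ big))
      (cong₂ _++_ (cong (λ k → replicate k 2) (∑σ mid)) (cong (λ k → replicate k 1) (∑σ leaf))))

  4≤2n : 4 ≤ 2 * n
  4≤2n = ≤-trans (m≤m+n 4 10) (*-monoʳ-≤ 2 7≤n)

  10≤4n : 10 ≤ 4 * n
  10≤4n = ≤-trans (m≤m+n 10 18) (*-monoʳ-≤ 4 7≤n)

  A≡0-if-3,3 : σ ≡ 3 ∷ 3 ∷ replicate (n ∸ 2) 2 → A ≡ 0
  A≡0-if-3,3 eq = trans (sym (∑σ leaf)) (trans (cong (∑ leaf) eq)
    (trans (∑-replicate leaf (n ∸ 2) 2) (*-zeroʳ (n ∸ 2))))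

  -- B is squeezed between 2 and A + 2 = 2, hence B = E = 2 and M = 2 (n - 2).
  no-leaves : A ≡ 0 → irrOf ds ≡ 2 * n ∸ 4 × σ ≡ 3 ∷ 3 ∷ replicate (n ∸ 2) 2
  no-leaves A≡0 = trans (sym (irrBound≡irr (1≤ds≤3 B≡E))) M≡2n-4 , σ≡
    where
    B≡2 : B ≡ 2
    B≡2 = ≤-antisym (≤-trans B≤A+2 (≤-reflexive (cong (_+ 2) A≡0))) 2≤B
    E≡2 : E ≡ 2
    E≡2 = trans E≡A+2 (cong (_+ 2) A≡0)
    B≡E : B ≡ E
    B≡E = trans B≡2 (sym E≡2)
    Z≡n-2 : Z ≡ n ∸ 2
    Z≡n-2 = trans (sym (m+n∸n≡m Z B)) (cong₂ _∸_ Z+B≡n B≡2)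
    M≡2n-4 : M ≡ 2 * n ∸ 4
    M≡2n-4 = trans (cong₂ _+_ (cong (_* N′) A≡0) (cong₂ _*_ E≡2 Z≡n-2)) (*-distribˡ-∸ 2 n 2)
    mid≡n-2 : ∑ mid ds ≡ n ∸ 2
    mid≡n-2 = trans (sym (m+n∸n≡m (∑ mid ds) B))
      (cong₂ _∸_ (trans (cong (λ a → a + ∑ mid ds + B) (sym A≡0)) A+mid+B≡n) B≡2)
    σ≡ : σ ≡ 3 ∷ 3 ∷ replicate (n ∸ 2) 2
    σ≡ = trans (profile B≡E)
      (trans (cong₂ _++_ (cong (λ k → replicate k 3) B≡2)
               (cong₂ _++_ (cong (λ k → replicate k 2) mid≡n-2) (cong (λ k → replicate k 1) A≡0)))
             (cong (λ ms → 3 ∷ 3 ∷ ms) (++-identityʳ _)))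

  module Leaves (A≢0 : A ≢ 0) where
    bound : 4 * n ≤ M + 10 × (M + 10 ≡ 4 * n → A ≡ 1 × B ≡ 3)
    bound with 4n≤ , tight ← leaf-bound A N′ B Z (n≢0⇒n>0 A≢0) 2≤B B≤A+2
                 (trans (+-comm B Z) (trans Z+B≡n (sym A+N′≡n))) (≤-trans 7≤n (≤-reflexive (sym A+N′≡n))) B≤N′
      = subst₂ _≤_ (cong (4 *_) A+N′≡n) M≡ 4n≤ ,
        λ eq → tight (trans M≡ (trans eq (cong (4 *_) (sym A+N′≡n))))
      where
      M≡ : A * N′ + (A + 2) * Z + 10 ≡ M + 10
      M≡ = cong (λ e → A * N′ + e * Z + 10) (sym E≡A+2)

    4n≤irr+10 : 4 * n ≤ irrOf ds + 10
    4n≤irr+10 = ≤-trans (proj₁ bound) (+-monoˡ-≤ 10 (irrBound≤irr ds))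

    4n-10≤irr : 4 * n ∸ 10 ≤ irrOf ds
    4n-10≤irr = m≤n+o⇒m∸n≤o (4 * n) 10 (≤-trans 4n≤irr+10 (≤-reflexive (+-comm (irrOf ds) 10)))

    -- Since 2 n ≥ 7, already 4 n - 10 exceeds 2 n - 4: a list with a leaf never attains the first
    -- bound.
    2n-4<irr : 2 * n ∸ 4 < irrOf ds
    2n-4<irr = ≤-trans (m+n≤o⇒m≤o∸n (suc (2 * n ∸ 4)) 2n+7≤4n) 4n-10≤irr
      where
      open ≤-Reasoning
      2n+7≤4n : suc (2 * n ∸ 4) + 10 ≤ 4 * n
      2n+7≤4n = begin
        suc (2 * n ∸ 4) + 10   ≡⟨ rearrange (2 * n ∸ 4) ⟩
        2 * n ∸ 4 + 4 + 7      ≡⟨ cong (_+ 7) (m∸n+n≡m 4≤2n) ⟩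
        2 * n + 7              ≤⟨ +-monoʳ-≤ (2 * n) (≤-trans 7≤n (m≤m+n n (n + 0))) ⟩
        2 * n + 2 * n          ≡⟨ *-distribʳ-+ n 2 2 ⟨
        4 * n ∎
        where
        rearrange : ∀ m → suc m + 10 ≡ m + 4 + 7
        rearrange = solve-∀

    σ≢ : σ ≢ 3 ∷ 3 ∷ replicate (n ∸ 2) 2
    σ≢ eq = A≢0 (A≡0-if-3,3 eq)

    B≡E : A ≡ 1 → B ≡ 3 → B ≡ E
    B≡E A≡1 B≡3 = trans B≡3 (sym (trans E≡A+2 (cong (_+ 2) A≡1)))

    to : irrOf ds ≡ 4 * n ∸ 10 → σ ≡ 3 ∷ 3 ∷ 3 ∷ replicate (n ∸ 4) 2 ++ 1 ∷ []
    to irr≡ = trans (profile (B≡E A≡1 B≡3))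
      (cong₂ _++_ (cong (λ k → replicate k 3) B≡3)
        (cong₂ _++_ (cong (λ k → replicate k 2) mid≡n-4) (cong (λ k → replicate k 1) A≡1)))
      where
      -- M lies between 4 n - 10 and `irrOf ds`, which coincide here; the equality case of
      -- `leaf-bound` then fixes A and B.
      M+10≡4n : M + 10 ≡ 4 * n
      M+10≡4n = ≤-antisym (≤-trans (+-monoˡ-≤ 10 (irrBound≤irr ds))
                  (≤-reflexive (trans (cong (_+ 10) irr≡) (m∸n+n≡m 10≤4n)))) (proj₁ bound)
      A≡1 : A ≡ 1
      A≡1 = proj₁ (proj₂ bound M+10≡4n)
      B≡3 : B ≡ 3
      B≡3 = proj₂ (proj₂ bound M+10≡4n)
      mid≡n-4 : ∑ mid ds ≡ n ∸ 4
      mid≡n-4 = trans (sym (m+n∸n≡m (∑ mid ds) 4)) (cong (_∸ 4)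
        (trans (rearrange (∑ mid ds)) (trans (cong₂ (λ a b → a + ∑ mid ds + b) (sym A≡1) (sym B≡3)) A+mid+B≡n)))
        where
        rearrange : ∀ m → m + 4 ≡ 1 + m + 3
        rearrange = solve-∀

    from : σ ≡ 3 ∷ 3 ∷ 3 ∷ replicate (n ∸ 4) 2 ++ 1 ∷ [] → irrOf ds ≡ 4 * n ∸ 10
    from σ≡ = trans (sym (irrBound≡irr (1≤ds≤3 (B≡E A≡1 B≡3))))
                    (trans (sym (m+n∸n≡m M 10)) (cong (_∸ 10) M+10≡4n))
      where
      -- A weight that vanishes at 2 sees only the three entries 3 and the entry 1.
      count : ∀ f → f 2 ≡ 0 → ∑ f ds ≡ f 3 + (f 3 + (f 3 + (f 1 + 0)))
      count f f2≡0 = trans (sym (∑σ f)) (trans (cong (∑ f) σ≡)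
        (cong (λ m → f 3 + (f 3 + (f 3 + m))) (begin
          sum (map f (replicate (n ∸ 4) 2 ++ 1 ∷ []))      ≡⟨ cong sum (map-++ f (replicate (n ∸ 4) 2) _) ⟩
          sum (map f (replicate (n ∸ 4) 2) ++ f 1 ∷ [])    ≡⟨ sum-++ (map f (replicate (n ∸ 4) 2)) _ ⟩
          ∑ f (replicate (n ∸ 4) 2) + (f 1 + 0)
            ≡⟨ cong (_+ (f 1 + 0)) (trans (∑-replicate f (n ∸ 4) 2) (trans (cong ((n ∸ 4) *_) f2≡0) (*-zeroʳ (n ∸ 4)))) ⟩
          f 1 + 0 ∎)))
        where open ≡-Reasoning
      A≡1 : A ≡ 1
      A≡1 = count leaf refl
      B≡3 : B ≡ 3
      B≡3 = count big refl
      Z+3≡n : Z + 3 ≡ n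
      Z+3≡n = trans (cong (Z +_) (sym B≡3)) Z+B≡n
      1+N′≡Z+3 : 1 + N′ ≡ Z + 3
      1+N′≡Z+3 = trans (cong (_+ N′) (sym A≡1)) (trans A+N′≡n (sym Z+3≡n))
      polynomial : ∀ z → 1 * (2 + z) + 3 * z + 10 ≡ 4 * (z + 3)
      polynomial = solve-∀
      N′≡2+Z : N′ ≡ 2 + Z
      N′≡2+Z = suc-injective (trans 1+N′≡Z+3 (+-comm Z 3))
      M+10≡4n : M + 10 ≡ 4 * n
      M+10≡4n = trans (cong (_+ 10) (cong₂ _+_ (cong₂ _*_ A≡1 N′≡2+Z)
                        (cong (_* Z) (trans E≡A+2 (cong (_+ 2) A≡1)))))
                      (trans (polynomial Z) (cong (4 *_) Z+3≡n))

  by-leaves : Dec (A ≡ 0) → _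
  by-leaves (yes A≡0) with irr≡ , σ≡ ← no-leaves A≡0 =
    (≤-reflexive (sym irr≡) , mk⇔ (λ _ → σ≡) (λ _ → irr≡)) , λ σ≢ → ⊥-elim (σ≢ σ≡)
  by-leaves (no A≢0) =
    (<⇒≤ 2n-4<irr , mk⇔ (λ irr≡ → ⊥-elim (<-irrefl (sym irr≡) 2n-4<irr)) (λ σ≡ → ⊥-elim (σ≢ σ≡))) ,
    λ _ → 4n-10≤irr , mk⇔ to from
    where open Leaves A≢0

-- Degrees in a graph: handshake lemma, positivity and branch vertices.

module _ {n : ℕ} (G : Graph n) where
  open Graph G

  private
    V : List (Fin n)
    V = allFin n

    degrees : List ℕ
    degrees = map (degree G) V

  length-degrees : length degrees ≡ n
  length-degrees = trans (length-map (degree G) V) (length-tabulate (λ x → x))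

  irrₜ≡irrOf : irrₜ G ≡ irrOf degrees
  irrₜ≡irrOf = cong (_/ 2) (trans (∑-cartesianProduct (λ (x , y) → ∣ degree G x - degree G y ∣) V V)
    (trans (∑-cong (λ x → cong sum (map-∘ V)) V) (cong sum (map-∘ V))))

  -- The neighbours of a vertex split into larger and smaller ones. Interchanging the summations
  -- shows that either kind counts every edge once.
  handshake : sum degrees ≡ 2 * numEdges G
  handshake = begin
    ∑ (degree G) V
      ≡⟨ ∑-cong (λ x → trans (length-filter≡∑ (x ~?_) V)
                             (trans (∑-cong (orient x) V) (∑-+ (e x) (λ y → e y x) V))) V ⟩
    ∑ (λ x → ∑ (e x) V + ∑ (λ y → e y x) V) V
      ≡⟨ ∑-+ (λ x → ∑ (e x) V) (λ x → ∑ (λ y → e y x) V) V ⟩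
    ∑ (λ x → ∑ (e x) V) V + ∑ (λ x → ∑ (λ y → e y x) V) V
      ≡⟨ cong (∑ (λ x → ∑ (e x) V) V +_) (∑-swap (λ x y → e y x) V V) ⟩
    ∑ (λ x → ∑ (e x) V) V + ∑ (λ x → ∑ (e x) V) V
      ≡⟨ cong₂ _+_ edges (trans edges (sym (+-identityʳ _))) ⟩
    2 * numEdges G ∎
    where
    open ≡-Reasoning
    e : Fin n → Fin n → ℕ
    e x y = ⟦ (x <? y) ×-dec (x ~? y) ⟧
    edges : ∑ (λ x → ∑ (e x) V) V ≡ numEdges G
    edges = sym (trans (length-filter≡∑ _ (cartesianProduct V V)) (∑-cartesianProduct _ V V))
    orient : ∀ x y → ⟦ x ~? y ⟧ ≡ e x y + e y x
    orient x y = ⟦⟧-⊎ (x ~? y) ((x <? y) ×-dec (x ~? y)) ((y <? x) ×-dec (y ~? x))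
      split proj₂ (~-sym ∘ proj₂) (λ (x<y , _) (y<x , _) → <-asymᶠ x<y y<x)
      where
      split : x ~ y → _
      split x~y with <-cmpᶠ x y
      ... | tri< x<y _ _ = inj₁ (x<y , x~y)
      ... | tri≈ _ x≡y _ = ⊥-elim (~-irrefl x≡y x~y)
      ... | tri> _ _ y<x = inj₂ (y<x , ~-sym x~y)

  neighbours≤degree : ∀ {x ys} → Unique ys → All (x ~_) ys → length ys ≤ degree G x
  neighbours≤degree {x} u x~ys = Unique⇒length≤ u (All.map (∈-filter⁺ (x ~?_) (∈-allFin _)) x~ys)

  -- A walk from `x` to a different vertex starts with an edge at `x`.
  connected⇒1≤degree : Connected G → ∀ {x y} → x ≢ y → 1 ≤ degree G x
  connected⇒1≤degree conn {x} {y} x≢y with conn x y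
  ... | ε       = ⊥-elim (x≢y refl)
  ... | x~z ◅ _ = neighbours≤degree ([] ∷ []) (x~z ∷ [])

  count-big : ∀ {us} → Unique us → All (λ u → 3 ≤ degree G u) us → length us ≤ ∑ big degrees
  count-big u 3≤us = ≤-trans
    (Unique⇒length≤ u (All.map (∈-filter⁺ (λ v → 3 ≤? degree G v) (∈-allFin _)) 3≤us))
    (≤-reflexive (trans (length-filter≡∑ (λ v → 3 ≤? degree G v) V) (cong sum (map-∘ V))))

  -- Each end of the joining path has two neighbours on its cycle and one on the path. The ends are
  -- distinct because l ≥ 2, and gluing trees keeps all edges of the base graph.
  two-branch-vertices : B⁺⁺ G → 2 ≤ ∑ big degrees
  two-branch-vertices b
    with B⁺⁺.p b | B⁺⁺.q b | B⁺⁺.l b | B⁺⁺.3≤p b | B⁺⁺.3≤q b | B⁺⁺.2≤l b | B⁺⁺.attached b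
  ... | p@(suc (suc (suc p′))) | q@(suc (suc (suc q′))) | l@(suc (suc l′))
      | 3≤p@(s≤s (s≤s (s≤s _))) | 3≤q@(s≤s (s≤s (s≤s _))) | s≤s (s≤s _) | att =
    count-big ((s≢t ∷ []) ∷ [] ∷ []) (3≤deg-s ∷ 3≤deg-t ∷ [])
    where
    open ObtainedByAttachingTrees att
    open Inverse iso using (to; from; strictlyInverseˡ)
    H = ∞-graph p q l 3≤p 3≤q
    s t e : ℕ
    s = suc (suc p′)
    t = s + suc l′
    e = t + suc (suc q′)

    -- Position i of the base graph is the root `zero` of the tree glued there.
    vertex : ∀ {i} → i ≤ e → Fin n
    vertex i≤e = from (fromℕ< (s≤s i≤e) , zero)

    vertex-≢ : ∀ {i j} (i≤e : i ≤ e) (j≤e : j ≤ e) → i ≢ j → vertex i≤e ≢ vertex j≤e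
    vertex-≢ i≤e j≤e i≢j eq = i≢j (trans (sym (toℕ-fromℕ< (s≤s i≤e))) (trans (cong (toℕ ∘ proj₁)
      (trans (sym (strictlyInverseˡ _)) (trans (cong to eq) (strictlyInverseˡ _)))) (toℕ-fromℕ< (s≤s j≤e))))

    vertex-~ : ∀ {i j} (i≤e : i ≤ e) (j≤e : j ≤ e) → ∞-Edge p q l i j → vertex i≤e ~ vertex j≤e
    vertex-~ i≤e j≤e i-j = Equivalence.from (iso-~ _ _)
      (subst₂ (GluedEdge H k T) (sym (strictlyInverseˡ _)) (sym (strictlyInverseˡ _))
        (base (inj₁ (subst₂ (∞-Edge p q l) (sym (toℕ-fromℕ< (s≤s i≤e))) (sym (toℕ-fromℕ< (s≤s j≤e))) i-j))))

    t<e : suc t ≤ e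
    t<e = ≤-trans (≤-reflexive (+-comm 1 t)) (+-monoʳ-≤ t (s≤s z≤n))
    t≤e : t ≤ e
    t≤e = <⇒≤ t<e
    s<t : suc s ≤ t
    s<t = ≤-trans (≤-reflexive (+-comm 1 s)) (+-monoʳ-≤ s (s≤s z≤n))
    1+t≢e : suc t ≢ e
    1+t≢e eq with () ← +-cancelˡ-≡ t _ _ (trans (+-comm t 1) eq)
    s≤e : s ≤ e
    s≤e = <⇒≤ (≤-trans s<t t≤e)

    s≢t : vertex s≤e ≢ vertex t≤e
    s≢t = vertex-≢ s≤e t≤e (<⇒≢ s<t)

    three : ∀ {i a b c} (i≤e : i ≤ e) (a≤e : a ≤ e) (b≤e : b ≤ e) (c≤e : c ≤ e) → a ≢ b → a ≢ c → b ≢ c →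
            vertex i≤e ~ vertex a≤e → vertex i≤e ~ vertex b≤e → vertex i≤e ~ vertex c≤e →
            3 ≤ degree G (vertex i≤e)
    three i≤e a≤e b≤e c≤e a≢b a≢c b≢c i~a i~b i~c = neighbours≤degree
      ((vertex-≢ a≤e b≤e a≢b ∷ vertex-≢ a≤e c≤e a≢c ∷ []) ∷ (vertex-≢ b≤e c≤e b≢c ∷ []) ∷ [] ∷ [])
      (i~a ∷ i~b ∷ i~c ∷ [])

    3≤deg-s : 3 ≤ degree G (vertex s≤e)
    -- The neighbours are 0 and s - 1 on the first cycle, distinct as p ≥ 3, and s + 1 on the path.
    3≤deg-s = three s≤e z≤n s-1≤e s+1≤e (λ ()) (λ ()) (<⇒≢ (m≤n⇒m≤1+n ≤-refl))
      (~-sym (vertex-~ z≤n s≤e (inj₁ (inj₂ (refl , refl)))))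
      (~-sym (vertex-~ s-1≤e s≤e (inj₁ (inj₁ (z≤n , refl , ≤-refl)))))
      (vertex-~ s≤e s+1≤e (inj₂ (inj₁ (≤-refl , refl , s<t))))
      where
      s-1≤e : suc p′ ≤ e
      s-1≤e = <⇒≤ s≤e
      s+1≤e : suc s ≤ e
      s+1≤e = ≤-trans s<t t≤e

    3≤deg-t : 3 ≤ degree G (vertex t≤e)
    -- The neighbours are t - 1 on the path, and t + 1 and e on the second cycle, distinct as q ≥ 3.
    3≤deg-t = three t≤e t-1≤e t<e ≤-refl (<⇒≢ (m≤n⇒m≤1+n ≤-refl)) (<⇒≢ (≤-trans ≤-refl t≤e)) 1+t≢e
      (~-sym (vertex-~ t-1≤e t≤e (inj₂ (inj₁ (≤-pred s<t , refl , ≤-refl)))))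
      (vertex-~ t≤e t<e (inj₂ (inj₂ (inj₁ (≤-refl , refl , t<e)))))
      (vertex-~ t≤e ≤-refl (inj₂ (inj₂ (inj₂ (refl , refl)))))
      where
      t-1≤e : suc (p′ + suc l′) ≤ e
      t-1≤e = <⇒≤ t≤e

-- Transfer of the bounds from degree lists to graphs.

theorem13 : ∀ (n : ℕ) → 7 ≤ n → (G : Graph n) → B⁺⁺ G →
    (2 * n ∸ 4 ≤ irrₜ G
    × (irrₜ G ≡ 2 * n ∸ 4 ⇔ degreeSequence G ≡ 3 ∷ 3 ∷ replicate (n ∸ 2) 2))
    × (¬ (degreeSequence G ≡ 3 ∷ 3 ∷ replicate (n ∸ 2) 2) →
    4 * n ∸ 10 ≤ irrₜ G
    × (irrₜ G ≡ 4 * n ∸ 10 ⇔ degreeSequence G ≡ 3 ∷ 3 ∷ 3 ∷ replicate (n ∸ 4) 2 ++ 1 ∷ []))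
theorem13 n 7≤n G b rewrite irrₜ≡irrOf G = irrOf-bounds 7≤n (length-degrees G)
  (All.map⁺ (All.universal 1≤degree (allFin n)))
  (trans (handshake G) (cong (2 *_) (proj₂ bicyclic)))
  (two-branch-vertices G b) (sort-↭ degrees) (Linked⇒AllPairs (λ i≥j j≥k → ≤-trans j≥k i≥j) (sort-↗ degrees))
  where
  open B⁺⁺ b using (bicyclic)
  open Sort (Flip.decTotalOrder ≤-decTotalOrder) using (sort-↭; sort-↗)
  degrees : List ℕ
  degrees = map (degree G) (allFin n)
  1≤degree : ∀ x → 1 ≤ degree G x
  -- With at least two vertices, every vertex has a different one to walk to: 1 for the vertex 0,
  -- and 0 for any other.
  1≤degree with ≤-trans (s≤s (s≤s z≤n)) 7≤n
  1≤degree | s≤s (s≤s _) = λ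
    { zero    → connected⇒1≤degree G (proj₁ bicyclic) {y = suc zero} (λ ())
    ; (suc _) → connected⇒1≤degree G (proj₁ bicyclic) {y = zero} (λ ()) }
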